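{- Let $d\ge 2$ and $N\ge 1$. Consider the following decision problem (the "piercing problem"). The input consists of real numbers $a^{(j)}_i<b^{(j)}_i$ for $i=0,1,\dots,N$ and $j=1,\dots,d$, satisfying $a^{(j)}_0\le a^{(j)}_i<b^{(j)}_i\le b^{(j)}_0$ for all $i=1,\dots,N$ and all $j$. Let $R_0=\prod_{j=1}^d[a^{(j)}_0,b^{(j)}_0]$. For each $i=1,\dots,N$, define the "cross" $$C_i=\{p\in R_0:\ p_j\in[a^{(j)}_i,b^{(j)}_i]\text{ for some }j\}.$$ Equivalently, $C_i$ is the complement in $R_0$ of the Cartesian product of the complements of $[a^{(j)}_i,b^{(j)}_i]$ in $[a^{(j)}_0,b^{(j)}_0]$. The question is whether $\bigcap_{i=1}^N C_i=\emptyset$. For $d=2$, the cross condition says that a pair of points $x\in[a^{(1)}_0,b^{(1)}_0]$, $y\in[a^{(2)}_0,b^{(2)}_0]$ "pierces" the $i$-th pair of intervals, i.e. $x\in[a^{(1)}_i,b^{(1)}_i]$ or $y\in[a^{(2)}_i,b^{(2)}_i]$. The question then asks whether there is no pair of points piercing all $N$ pairs. An algorithm accesses the input only through queries. A query picks two endpoints belonging to the same coordinate $j$, i.e. two elements of $X_j=\{a^{(j)}_0,\dots,a^{(j)}_N,b^{(j)}_0,\dots,b^{(j)}_N\}$, and receives the answer to which of $x<x'$, $x=x'$, $x>x'$ holds. The algorithm is adaptive: the choice of each query may depend on earlier answers. It must decide correctly, for every admissible input, whether $\bigcap_{i=1}^N C_i=\emptyset$. Then, already for $d=2$ (and hence for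 every $d\ge2$), $O(N)$ queries do not suffice. More precisely, the worst-case number of queries required by any such algorithm is $\Omega(N\log N)$ as $N\to\infty$.
   Context: The worst case is taken over all admissible inputs. $\Omega(N\log N)$ means that there is a constant $c>0$ such that, for all sufficiently large $N$, every correct algorithm uses at least $cN\log N$ queries on some input.
   Formalization: The endpoints of the intervals and the piercing points are taken to be rational instead of real numbers; the real lower bound follows, since a piercing point for rational endpoints can be chosen with rational coordinates. -}

module Defs where

open import Data.Nat using (ℕ; zero; suc; _+_; _*_; _≤_)
open import Data.Nat.Logarithm using (⌊log₂_⌋)
open import Data.Fin using (Fin) renaming (zero to fzero; suc to fsuc)
open import Data.Bool using (Bool; true; false; if_then_else_)
open import Data.Product using (Σ; ∃; _×_; _,_)
open import Data.Rational using (ℚ) renaming (_≤_ to _≤ℚ_; _<_ to _<ℚ_)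
open import Data.Rational.Properties using (_<?_; _≟_)
open import Relation.Nullary using (¬_; does)
open import Relation.Binary.PropositionalEquality using (_≡_)
open import Function.Bundles using (_⇔_)

-- An input of the piercing problem in dimension d with N crosses:
-- lower endpoints a j i and upper endpoints b j i, for coordinate j : Fin d
-- and index i : Fin (suc N) (index 0 is the bounding box R_0).
record Input (d N : ℕ) : Set where
  constructor mkInput
  field
    a : Fin d → Fin (suc N) → ℚ
    b : Fin d → Fin (suc N) → ℚ
open Input public

Admissible : ∀ {d N} → Input d N → Set
Admissible {d} {N} I =
  (∀ (j : Fin d) (i : Fin (suc N)) → a I j i <ℚ b I j i) ×
  (∀ (j : Fin d) (i : Fin (suc N)) → (a I j fzero ≤ℚ a I j i) × (b I j i ≤ℚ b I j fzero))

InBox : ∀ {d N} → Input d N → (Fin d → ℚ) → Set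
InBox {d} I p = ∀ (j : Fin d) → (a I j fzero ≤ℚ p j) × (p j ≤ℚ b I j fzero)

InCross : ∀ {d N} → Input d N → Fin N → (Fin d → ℚ) → Set
InCross {d} I i p =
  InBox I p × ∃ λ (j : Fin d) → (a I j (fsuc i) ≤ℚ p j) × (p j ≤ℚ b I j (fsuc i))

IntersectionEmpty : ∀ {d N} → Input d N → Set
IntersectionEmpty {d} {N} I =
  ¬ (∃ λ (p : Fin d → ℚ) → InBox I p × (∀ (i : Fin N) → InCross I i p))

-- An endpoint of a fixed coordinate: index i together with a flag
-- (false = a_i, true = b_i).  X_j is the set of these endpoints for coordinate j.
Endpoint : ℕ → Set
Endpoint N = Fin (suc N) × Bool

value : ∀ {d N} → Input d N → Fin d → Endpoint N → ℚ
value I j (i , false) = a I j i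
value I j (i , true)  = b I j i

data Answer : Set where
  lt eq gt : Answer

compareℚ : ℚ → ℚ → Answer
compareℚ x y =
  if does (x <? y) then lt else (if does (x ≟ y) then eq else gt)

-- Adaptive comparison algorithms = decision trees.  A node queries two
-- endpoints of the same coordinate j and branches on the three-way answer;
-- a leaf outputs the decision (true = "the intersection is empty").
data Tree (d N : ℕ) : Set where
  leaf : Bool → Tree d N
  query : Fin d → Endpoint N → Endpoint N → (Answer → Tree d N) → Tree d N

run : ∀ {d N} → Tree d N → Input d N → Bool
run (leaf r) I = r
run (query j e e′ k) I = run (k (compareℚ (value I j e) (value I j e′))) I

cost : ∀ {d N} → Tree d N → Input d N → ℕ
cost (leaf r) I = 0
cost (query j e e′ k) I = suc (cost (k (compareℚ (value I j e) (value I j e′))) I)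

Correct : ∀ {d N} → Tree d N → Set
Correct {d} {N} t =
  ∀ (I : Input d N) → Admissible I → (run t I ≡ true) ⇔ IntersectionEmpty I

{-# OPTIONS --safe #-}
module Submission where

-- Arrange fixed crosses in the plane whose common part is bounded by a staircase with n corners,
-- and add n moving crosses, each able to exclude exactly one corner.  The intersection is empty
-- iff every corner is excluded, which happens when the moving crosses are matched with the
-- corners by a permutation.  The endpoints depend affinely on the positions of the moving
-- crosses, and the answers along a branch of the tree are preserved by averaging inputs; but the
-- average of two different permutations is never onto.  So distinct permutations reach distinct
-- leaves, and n! ≤ 3 ^ cost.
--
-- In dimension d there are d − 1 copies of this family of crosses, with disjoint intervals in
-- each coordinate beyond the first two, so that these coordinates cannot hit all the copies.

open import Defs
open import Data.Nat using (ℕ; _*_; _≤_)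
open import Data.Nat.Logarithm using (⌊log₂_⌋)
open import Data.Product using (Σ; ∃; _×_; _,_)
open import Data.Nat using (⌊_/2⌋; ⌈_/2⌉; zero; suc; _+_; _∸_; _^_; _<_; z≤n; s≤s)
open import Data.Nat.Properties
open import Data.Nat.Logarithm using (⌊log₂⌋-mono-≤; ⌊log₂⌊n/2⌋⌋≡⌊log₂n⌋∸1; ⌊log₂[2^n]⌋≡n)
open import Data.Nat.Coprimality as Coprimality using (1-coprimeTo)
open import Data.Nat.Tactic.RingSolver using (solve-∀)
open import Algebra.Properties.CommutativeSemigroup +-commutativeSemigroup using (x∙yz≈y∙xz)
import Data.Integer as ℤ
import Data.Integer.Properties as ℤ
open import Data.Rational using (ℚ; mkℚ; *≤*; *<*) renaming (_≤_ to _≤ℚ_; _<_ to _<ℚ_)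
import Data.Rational.Properties as ℚ
open import Data.Bool using (true; false)
open import Data.Fin as Fin using (Fin; toℕ; splitAt; join; remQuot; combine; inject≤)
  renaming (zero to fzero; suc to fsuc)
import Data.Fin.Properties as Fin
open import Data.List using (List; []; _∷_; length; filter; allFin; cartesianProduct; map)
open import Data.List.Properties using (length-tabulate; length-map; length-++)
open import Data.List.Membership.Propositional using (_∈_)
open import Data.List.Membership.Propositional.Properties using (∈-filter⁻)
open import Data.List.Relation.Unary.Any using (here; there)
open import Data.List.Relation.Unary.All using ([]; _∷_)
open import Data.List.Relation.Unary.AllPairs using ([]; _∷_)
open import Data.List.Relation.Unary.Unique.Propositional using (Unique)
open import Data.List.Relation.Unary.Unique.Propositional.Properties
  using (filter⁺; cartesianProduct⁺; allFin⁺)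
open import Data.Vec.Functional using (insertAt)
open import Data.Vec.Functional.Properties using (insertAt-lookup; insertAt-punchIn)
open import Data.Product using (∃₂; proj₁; proj₂; map₂)
open import Data.Sum using (_⊎_; inj₁; inj₂; [_,_]′)
open import Data.Unit using (⊤; tt)
open import Data.Empty using (⊥; ⊥-elim)
open import Function using (_∘_)
open import Function.Bundles using (module Equivalence)
open import Relation.Nullary using (¬_; yes; no; contradiction)
open import Relation.Nullary.Decidable using (_×-dec_; dec-true; dec-false)
open import Relation.Binary.Definitions using (DecidableEquality; tri<; tri≈; tri>)
open import Relation.Binary.PropositionalEquality

-- Natural numbers as rationals, and three-way comparison

ι : ℕ → ℚ
ι n = mkℚ (ℤ.+ n) 0 (Coprimality.sym (1-coprimeTo n))

ι-mono-≤ : ∀ {m n} → m ≤ n → ι m ≤ℚ ι n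
ι-mono-≤ m≤n = *≤* (ℤ.*-monoʳ-≤-nonNeg (ℤ.+ 1) (ℤ.+≤+ m≤n))

ι-mono-< : ∀ {m n} → m < n → ι m <ℚ ι n
ι-mono-< m<n = *<* (ℤ.*-monoʳ-<-pos (ℤ.+ 1) (ℤ.+<+ m<n))

ι-gap : ∀ {m n v} → m < n → ι n ≤ℚ v → ¬ (v ≤ℚ ι m)
ι-gap m<n n≤v v≤m = ℚ.<-irrefl refl (ℚ.<-≤-trans (ι-mono-< m<n) (ℚ.≤-trans n≤v v≤m))

compareℕ : ℕ → ℕ → Answer
compareℕ m n with <-cmp m n
... | tri< _ _ _ = lt
... | tri≈ _ _ _ = eq
... | tri> _ _ _ = gt

compare-ι : ∀ m n → compareℚ (ι m) (ι n) ≡ compareℕ m n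
compare-ι m n with <-cmp m n
... | tri< m<n _ _ rewrite dec-true (ι m ℚ.<? ι n) (ι-mono-< m<n) = refl
... | tri≈ _ refl _
  rewrite dec-false (ι m ℚ.<? ι m) (ℚ.<-irrefl refl)
        | dec-true (ι m ℚ.≟ ι m) refl = refl
... | tri> _ _ n<m
  rewrite dec-false (ι m ℚ.<? ι n) (ℚ.<-asym (ι-mono-< n<m))
        | dec-false (ι m ℚ.≟ ι n) (λ m≡n → ℚ.<-irrefl (sym m≡n) (ι-mono-< n<m)) = refl

-- Two instances of the same relation `<`, `≡` or `>` can be added, and the factor 2 cancels.
-- Midpoints are given by doubled equations, so no division occurs.
compareℕ-midpoint : ∀ {m m₁ m₂ n n₁ n₂} → 2 * m ≡ m₁ + m₂ → 2 * n ≡ n₁ + n₂ →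
  compareℕ m₁ n₁ ≡ compareℕ m₂ n₂ → compareℕ m n ≡ compareℕ m₁ n₁
compareℕ-midpoint {m} {m₁} {m₂} {n} {n₁} {n₂} em en same
  with <-cmp m₁ n₁ | <-cmp m₂ n₂ | <-cmp m n
... | tri< a _ _ | tri< b _ _ | tri< _ _ _ = refl
... | tri< a _ _ | tri< b _ _ | tri≈ ¬c _ _ = contradiction
  (*-cancelˡ-< 2 m n (subst₂ _<_ (sym em) (sym en) (+-mono-< a b))) ¬c
... | tri< a _ _ | tri< b _ _ | tri> ¬c _ _ = contradiction
  (*-cancelˡ-< 2 m n (subst₂ _<_ (sym em) (sym en) (+-mono-< a b))) ¬c
... | tri≈ _ a _ | tri≈ _ b _ | tri≈ _ _ _ = refl
... | tri≈ _ a _ | tri≈ _ b _ | tri< _ ¬c _ = contradiction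
  (*-cancelˡ-≡ m n 2 (trans em (trans (cong₂ _+_ a b) (sym en)))) ¬c
... | tri≈ _ a _ | tri≈ _ b _ | tri> _ ¬c _ = contradiction
  (*-cancelˡ-≡ m n 2 (trans em (trans (cong₂ _+_ a b) (sym en)))) ¬c
... | tri> _ _ a | tri> _ _ b | tri> _ _ _ = refl
... | tri> _ _ a | tri> _ _ b | tri< _ _ ¬c = contradiction
  (*-cancelˡ-< 2 n m (subst₂ _<_ (sym en) (sym em) (+-mono-< a b))) ¬c
... | tri> _ _ a | tri> _ _ b | tri≈ _ _ ¬c = contradiction
  (*-cancelˡ-< 2 n m (subst₂ _<_ (sym en) (sym em) (+-mono-< a b))) ¬c
... | tri< _ _ _ | tri≈ _ _ _ | _ = contradiction same λ ()
... | tri< _ _ _ | tri> _ _ _ | _ = contradiction same λ ()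
... | tri≈ _ _ _ | tri< _ _ _ | _ = contradiction same λ ()
... | tri≈ _ _ _ | tri> _ _ _ | _ = contradiction same λ ()
... | tri> _ _ _ | tri< _ _ _ | _ = contradiction same λ ()
... | tri> _ _ _ | tri≈ _ _ _ | _ = contradiction same λ ()

-- Leaves of a decision tree

ask : ∀ {d N} → Fin d → Endpoint N → Endpoint N → Input d N → Answer
ask j e e′ I = compareℚ (value I j e) (value I j e′)

-- Recorded as agreement at every query of the path, because averaging preserves answers query by
-- query.
data SameLeaf {d N} : Tree d N → Input d N → Input d N → Set where
  leaf  : ∀ {r I J} → SameLeaf (leaf r) I J
  query : ∀ {j e e′ k I J} → ask j e e′ I ≡ ask j e e′ J →
          SameLeaf (k (ask j e e′ I)) I J → SameLeaf (query j e e′ k) I J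

-- At each query on the common path of `I` and `J`, `M` receives their common answer, so it follows
-- them down to the leaf.
run-between : ∀ {d N} {M I J : Input d N} →
  (∀ j e e′ → ask j e e′ I ≡ ask j e e′ J → ask j e e′ M ≡ ask j e e′ I) →
  ∀ {t} → SameLeaf t I J → run t M ≡ run t I
run-between between leaf = refl
run-between between (query {j} {e} {e′} same rest)
  rewrite between j e e′ same = run-between between rest

_≟A_ : DecidableEquality Answer
lt ≟A lt = yes refl
lt ≟A eq = no λ ()
lt ≟A gt = no λ ()
eq ≟A lt = no λ ()
eq ≟A eq = yes refl
eq ≟A gt = no λ ()
gt ≟A lt = no λ ()
gt ≟A eq = no λ ()
gt ≟A gt = yes refl

module _ {A : Set} (f : A → Answer) where

  fibre : Answer → List A → List A
  fibre r = filter (λ x → f x ≟A r)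

  length-fibres : ∀ xs → length xs ≡
    length (fibre lt xs) + length (fibre eq xs) + length (fibre gt xs)
  length-fibres [] = refl
  length-fibres (x ∷ xs) with f x
  ... | lt = cong suc (length-fibres xs)
  ... | eq = trans (cong suc (length-fibres xs))
    (cong (_+ length (fibre gt xs)) (sym (+-suc (length (fibre lt xs)) _)))
  ... | gt = trans (cong suc (length-fibres xs)) (sym (+-suc _ _))

largest : ∀ (f : Answer → ℕ) → ∃ λ r → f lt + f eq + f gt ≤ 3 * f r
largest f with maximum
  where
  maximum : ∃ λ r → ∀ s → f s ≤ f r
  maximum with ≤-total (f lt) (f eq) | ≤-total (f eq) (f gt) | ≤-total (f lt) (f gt)
  ... | inj₁ p | inj₁ q | _ = gt , λ { lt → ≤-trans p q ; eq → q ; gt → ≤-refl }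
  ... | inj₁ p | inj₂ q | _ = eq , λ { lt → p ; eq → ≤-refl ; gt → q }
  ... | inj₂ p | _ | inj₁ q = gt , λ { lt → q ; eq → ≤-trans p q ; gt → ≤-refl }
  ... | inj₂ p | _ | inj₂ q = lt , λ { lt → ≤-refl ; eq → p ; gt → q }
... | r , r-max = r , (begin
  f lt + f eq + f gt     ≤⟨ +-mono-≤ (+-mono-≤ (r-max lt) (r-max eq)) (r-max gt) ⟩
  f r + f r + f r        ≡⟨ +-assoc (f r) (f r) (f r) ⟩
  f r + (f r + f r)      ≡⟨ cong (λ a → f r + (f r + a)) (+-identityʳ (f r)) ⟨
  3 * f r                ∎)
  where open ≤-Reasoning

-- Pigeonhole: the most frequent of the three answers keeps at least a third of the list.
large-fibre : ∀ {A : Set} (f : A → Answer) xs →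
  ∃ λ r → length xs ≤ 3 * length (fibre f r xs)
large-fibre f xs with largest (λ r → length (fibre f r xs))
... | r , big = r , ≤-trans (≤-reflexive (length-fibres f xs)) big

1≤*⇒1≤ : ∀ m {n} → 1 ≤ m * n → 1 ≤ n
1≤*⇒1≤ m {zero}  1≤0 = ≤-trans 1≤0 (≤-reflexive (*-zeroʳ m))
1≤*⇒1≤ m {suc n} _   = s≤s z≤n

∈-fibre⁻ : ∀ {A : Set} (f : A → Answer) r xs {x} → x ∈ fibre f r xs → x ∈ xs × f x ≡ r
∈-fibre⁻ f r xs = ∈-filter⁻ (λ x → f x ≟A r) {xs = xs}

-- An adversary always gives the most frequent answer. Each query then divides the list by at most
-- 3, and any input that survives to the leaf has paid for the whole path.
fooling-bound : ∀ {d N} {A : Set} (I : A → Input d N) (t : Tree d N) (xs : List A) →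
  Unique xs → 1 ≤ length xs →
  (∀ {x y} → x ∈ xs → y ∈ xs → SameLeaf t (I x) (I y) → x ≡ y) →
  ∃ λ x → x ∈ xs × length xs ≤ 3 ^ cost t (I x)
fooling-bound I (leaf _) (x ∷ []) _ _ _ = x , here refl , ≤-refl
-- All inputs left at a leaf share it, so there cannot be two.
fooling-bound I (leaf _) (x ∷ y ∷ xs) ((x≢y ∷ _) ∷ _) _ inj =
  contradiction (inj (here refl) (there (here refl)) leaf) x≢y
fooling-bound {A = A} I (query j e e′ k) xs uniq 1≤xs inj = conclude
  (fooling-bound I (k r) ys (filter⁺ (λ x → ask j e e′ (I x) ≟A r) uniq)
    (1≤*⇒1≤ 3 (≤-trans 1≤xs xs≤3ys)) inj-ys)
  where
  r : Answer
  r = proj₁ (large-fibre (λ x → ask j e e′ (I x)) xs)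

  ys : List A
  ys = fibre (λ x → ask j e e′ (I x)) r xs

  xs≤3ys : length xs ≤ 3 * length ys
  xs≤3ys = proj₂ (large-fibre (λ x → ask j e e′ (I x)) xs)

  inj-ys : ∀ {x y} → x ∈ ys → y ∈ ys → SameLeaf (k r) (I x) (I y) → x ≡ y
  inj-ys {x} {y} x∈ys y∈ys same =
    let x∈xs , x-answer = ∈-fibre⁻ (λ x → ask j e e′ (I x)) r xs x∈ys
        y∈xs , y-answer = ∈-fibre⁻ (λ x → ask j e e′ (I x)) r xs y∈ys
    in inj x∈xs y∈xs (query (trans x-answer (sym y-answer))
         (subst (λ s → SameLeaf (k s) (I x) (I y)) (sym x-answer) same))

  conclude : (∃ λ x → x ∈ ys × length ys ≤ 3 ^ cost (k r) (I x)) →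
    ∃ λ x → x ∈ xs × length xs ≤ 3 ^ cost (query j e e′ k) (I x)
  conclude (x , x∈ys , ys≤) =
    let x∈xs , x-answer = ∈-fibre⁻ (λ x → ask j e e′ (I x)) r xs x∈ys
    in x , x∈xs , ≤-trans xs≤3ys
      (*-monoʳ-≤ 3 (subst (λ s → length ys ≤ 3 ^ cost (k s) (I x)) (sym x-answer) ys≤))

-- Permutations

-- The values 0, …, n − 1 are inserted in increasing order, each at a recorded position.
Code : ℕ → Set
Code zero    = ⊤
Code (suc n) = Fin (suc n) × Code n

perm : ∀ {n} → Code n → Fin n → ℕ
perm {suc n} (r , c) = insertAt (perm c) r n

codes : ∀ n → List (Code n)
codes zero    = tt ∷ []
codes (suc n) = cartesianProduct (allFin (suc n)) (codes n)

codes-unique : ∀ n → Unique (codes n)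
codes-unique zero    = [] ∷ []
codes-unique (suc n) = cartesianProduct⁺ (allFin⁺ (suc n)) (codes-unique n)

length-cartesianProduct : ∀ {A B : Set} (xs : List A) (ys : List B) →
  length (cartesianProduct xs ys) ≡ length xs * length ys
length-cartesianProduct [] ys = refl
length-cartesianProduct (x ∷ xs) ys = trans (length-++ (map (x ,_) ys))
  (cong₂ _+_ (length-map (x ,_) ys) (length-cartesianProduct xs ys))

length-codes-suc : ∀ n → length (codes (suc n)) ≡ suc n * length (codes n)
length-codes-suc n = trans (length-cartesianProduct (allFin (suc n)) (codes n))
  (cong (_* length (codes n)) (length-tabulate {n = suc n} (λ i → i)))

1≤length-codes : ∀ n → 1 ≤ length (codes n)
1≤length-codes zero    = s≤s z≤n
1≤length-codes (suc n) rewrite length-codes-suc n =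
  ≤-trans (1≤length-codes n) (m≤m+n _ _)

-- The list has (j + m)! entries, and the top `j` factors of this factorial are each at least `m`.
^-≤-length-codes : ∀ m j → m ^ j ≤ length (codes (j + m))
^-≤-length-codes m zero    = 1≤length-codes m
^-≤-length-codes m (suc j) rewrite length-codes-suc (j + m) =
  *-mono-≤ (≤-trans (m≤n+m m j) (n≤1+n (j + m))) (^-≤-length-codes m j)

-- The two cases in which a lookup in `insertAt` at `r` is known: the inserted entry and a shifted
-- old one.
data PunchView {n} (r : Fin (suc n)) : Fin (suc n) → Set where
  at   : PunchView r r
  away : ∀ k → PunchView r (Fin.punchIn r k)

punchView : ∀ {n} (r k : Fin (suc n)) → PunchView r k
punchView r k with r Fin.≟ k
... | yes refl = at
... | no r≢k   = subst (PunchView r) (Fin.punchIn-punchOut r≢k) (away (Fin.punchOut r≢k))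

perm< : ∀ {n} (c : Code n) k → perm c k < n
perm< {suc n} (r , c) k with punchView r k
... | at     rewrite insertAt-lookup (perm c) r n = ≤-refl
... | away k rewrite insertAt-punchIn (perm c) r n k = m<n⇒m<1+n (perm< c k)

perm-surjective : ∀ {n} (c : Code n) {i} → i < n → ∃ λ k → perm c k ≡ i
perm-surjective {suc n} (r , c) (s≤s i≤n) with m≤n⇒m<n∨m≡n i≤n
... | inj₂ refl = r , insertAt-lookup (perm c) r n
... | inj₁ i<n with perm-surjective c i<n
...   | k , eq′ = Fin.punchIn r k , trans (insertAt-punchIn (perm c) r n k) eq′

perm-max : ∀ {n} (r : Fin (suc n)) (c : Code n) k → n ≤ perm (r , c) k → r ≡ k
perm-max {n} r c k n≤ with punchView r k
... | at = refl
... | away k rewrite insertAt-punchIn (perm c) r n k = contradiction (perm< c k) (≤⇒≯ n≤)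

2*≡+ : ∀ n → 2 * n ≡ n + n
2*≡+ n = cong (n +_) (+-identityʳ n)

half-sum-max : ∀ {n} a {b} → b ≤ n → a + b ≡ 2 * n → n ≤ a
half-sum-max {n} a {b} b≤n sum = +-cancelʳ-≤ n n a (begin
  n + n      ≡⟨ 2*≡+ n ⟨
  2 * n      ≡⟨ sum ⟨
  a + b      ≤⟨ +-monoʳ-≤ a b≤n ⟩
  a + n      ∎)
  where open ≤-Reasoning

-- Two permutations average to the largest value only where both attain it, so the
-- positions of the values are recovered from the top down.
midpoint-surjective⇒≡ : ∀ {n} (c c′ : Code n) →
  (∀ i → i < n → ∃ λ k → perm c k + perm c′ k ≡ 2 * i) → c ≡ c′
midpoint-surjective⇒≡ {zero} tt tt _ = refl
midpoint-surjective⇒≡ {suc n} (r , c) (r′ , c′) onto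
  = cong₂ _,_ (trans r≡k (sym r′≡k))
      (midpoint-surjective⇒≡ c c′ (onto′ (trans r≡k (sym r′≡k))))
  where
  k = proj₁ (onto n ≤-refl)
  sum = proj₂ (onto n ≤-refl)

  r≡k : r ≡ k
  r≡k = perm-max r c k (half-sum-max _ (≤-pred (perm< (r′ , c′) k)) sum)

  r′≡k : r′ ≡ k
  r′≡k = perm-max r′ c′ k (half-sum-max _ (≤-pred (perm< (r , c) k))
    (trans (+-comm (perm (r′ , c′) k) _) sum))

  onto′ : r ≡ r′ → ∀ i → i < n → ∃ λ k → perm c k + perm c′ k ≡ 2 * i
  onto′ refl i i<n with onto i (m<n⇒m<1+n i<n)
  ... | k , sum with punchView r k
  -- Here both permutations take the value `n`, and the sum 2n is too large for i < n.
  ...   | at rewrite insertAt-lookup (perm c) r n | insertAt-lookup (perm c′) r n =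
    contradiction (*-cancelˡ-≡ i n 2 (sym (trans (2*≡+ n) sum))) (<⇒≢ i<n)
  ...   | away k rewrite insertAt-punchIn (perm c) r n k | insertAt-punchIn (perm c′) r n k =
    k , sum

-- Inputs

-- There are n = m + 1 corners: n moving crosses to exclude them, and n + 1 fixed ones, since corner
-- i lies between the fixed crosses i and i + 1.
data Shape (m : ℕ) : Set where
  fixed   : Fin (suc (suc m)) → Shape m
  moving  : Fin (suc m) → Shape m
  central : Shape m

Kind : ℕ → ℕ → Set
Kind e m = Fin (suc e) × Shape m

shapeCount : ℕ → ℕ
shapeCount m = suc (suc (suc m) + suc m)

decodeShape : ∀ {m} → Fin (shapeCount m) → Shape m
decodeShape fzero    = central
decodeShape {m} (fsuc i) = [ fixed , moving ]′ (splitAt (suc (suc m)) i)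

encodeShape : ∀ {m} → Shape m → Fin (shapeCount m)
encodeShape {m} (fixed i)  = fsuc (join (suc (suc m)) (suc m) (inj₁ i))
encodeShape {m} (moving k) = fsuc (join (suc (suc m)) (suc m) (inj₂ k))
encodeShape     central    = fzero

decode∘encodeShape : ∀ {m} (s : Shape m) → decodeShape (encodeShape s) ≡ s
decode∘encodeShape {m} (fixed i)
  rewrite Fin.splitAt-join (suc (suc m)) (suc m) (inj₁ i) = refl
decode∘encodeShape {m} (moving k)
  rewrite Fin.splitAt-join (suc (suc m)) (suc m) (inj₂ k) = refl
decode∘encodeShape central = refl

-- Indices beyond `K` all go to `K`, so surplus crosses become copies of the last kind.
clamp : ∀ {K N} → K < N → Fin N → Fin (suc K)
clamp {zero}  _         _        = fzero
clamp {suc K} (s≤s K<N) fzero    = fzero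
clamp {suc K} (s≤s K<N) (fsuc i) = fsuc (clamp K<N i)

clamp-inject≤ : ∀ {K N} (K<N : K < N) i → clamp K<N (inject≤ i K<N) ≡ i
clamp-inject≤ {zero}  (s≤s K<N) fzero    = refl
clamp-inject≤ {suc K} (s≤s K<N) fzero    = refl
clamp-inject≤ {suc K} (s≤s K<N) (fsuc i) = cong fsuc (clamp-inject≤ K<N i)

-- Only one composite is the identity: every kind must occur, while repeated crosses do not change
-- the intersection.
kinds : ∀ e m {N} → suc e * shapeCount m ≤ N →
  ∃₂ λ (decode : Fin N → Kind e m) (encode : Kind e m → Fin N) →
    ∀ κ → decode (encode κ) ≡ κ
kinds e m count≤N = decode , encode , decode∘encode
  where
  decode : Fin _ → Kind e m
  decode i = map₂ decodeShape (remQuot {suc e} (shapeCount m) (clamp count≤N i))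

  encode : Kind e m → Fin _
  encode (g , s) = inject≤ (combine g (encodeShape s)) count≤N

  decode∘encode : ∀ κ → decode (encode κ) ≡ κ
  decode∘encode (g , s) = begin
    map₂ decodeShape (remQuot (shapeCount m) (clamp count≤N (encode (g , s))))
      ≡⟨ cong (map₂ decodeShape ∘ remQuot (shapeCount m))
           (clamp-inject≤ count≤N (combine g (encodeShape s))) ⟩
    map₂ decodeShape (remQuot (shapeCount m) (combine g (encodeShape s)))
      ≡⟨ cong (map₂ decodeShape) (Fin.remQuot-combine g (encodeShape s)) ⟩
    g , decodeShape (encodeShape s)
      ≡⟨ cong (g ,_) (decode∘encodeShape s) ⟩
    g , s ∎
    where open ≡-Reasoning

-- In the first two coordinates, a cross of shape fixed i misses the quadrant x > 2i + 1,
-- y < 2i + 2, a cross of shape moving k misses the quadrant x < w k + 4, y > w k + 1, and the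
-- central cross misses the four corners of the box.  There is a copy of each cross for every group g; the remaining coordinates
-- separate the groups.
module Crosses (e m : ℕ) where

  -- Leaves room for moving intervals starting at `4 + w k` with `w k ≤ 2 * m`, and for group
  -- intervals ending at 1 + 2e or earlier.
  bound : ℕ
  bound = 5 + (2 * m + 2 * e)

  lower upper : (Fin (suc m) → ℕ) → Fin (2 + e) → Kind e m → ℕ
  lower w fzero           (g , fixed i)  = 0
  lower w fzero           (g , moving k) = 4 + w k
  lower w fzero           (g , central)  = 2
  lower w (fsuc fzero)    (g , fixed i)  = 2 + 2 * toℕ i
  lower w (fsuc fzero)    (g , moving k) = 0
  lower w (fsuc fzero)    (g , central)  = 2
  lower w (fsuc (fsuc j)) (g , s)        = 2 * toℕ g

  upper w fzero           (g , fixed i)  = 1 + 2 * toℕ i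
  upper w fzero           (g , moving k) = bound
  upper w fzero           (g , central)  = 1 + 2 * suc m
  upper w (fsuc fzero)    (g , fixed i)  = bound
  upper w (fsuc fzero)    (g , moving k) = 1 + w k
  upper w (fsuc fzero)    (g , central)  = 1 + 2 * suc m
  upper w (fsuc (fsuc j)) (g , s)        = 1 + 2 * toℕ g

  Hit : (Fin (suc m) → ℕ) → Kind e m → (Fin (2 + e) → ℚ) → Set
  Hit w κ p = ∃ λ j → ι (lower w j κ) ≤ℚ p j × p j ≤ℚ ι (upper w j κ)

  2+2*≤ : ∀ {i} → i ≤ suc m → 2 + 2 * i ≤ 4 + (2 * m + 2 * e)
  2+2*≤ {i} i≤ = begin
    2 + 2 * i                ≤⟨ +-monoʳ-≤ 2 (*-monoʳ-≤ 2 i≤) ⟩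
    2 + 2 * suc m            ≡⟨ cong (2 +_) (*-suc 2 m) ⟩
    4 + 2 * m                ≤⟨ +-monoʳ-≤ 4 (m≤m+n (2 * m) (2 * e)) ⟩
    4 + (2 * m + 2 * e)      ∎
    where open ≤-Reasoning

  -- An uncovered point would climb the staircase: y ≥ 2i + 2 forces x ≥ 2i + 4 by the moving
  -- cross with w k = 2i, and this forces y ≥ 2i + 4 by the next fixed cross.
  climb : ∀ {w : Fin (suc m) → ℕ} {x y : ℚ} → (∀ i → i ≤ m → ∃ λ k → w k ≡ 2 * i) →
    (∀ i → x ≤ℚ ι (1 + 2 * toℕ {suc (suc m)} i) ⊎ ι (2 + 2 * toℕ i) ≤ℚ y) →
    (∀ k → ι (4 + w k) ≤ℚ x ⊎ y ≤ℚ ι (1 + w k)) →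
    (ι 2 ≤ℚ x × x ≤ℚ ι (1 + 2 * suc m)) ⊎ (ι 2 ≤ℚ y × y ≤ℚ ι (1 + 2 * suc m)) → ⊥
  climb {w} {x} {y} onto hitFixed hitMoving hitCentral =
    -- At the top, x ≥ 2m + 4, and the last fixed cross gives the same for y: both lie beyond the
    -- central interval.
    [ ι-gap ≤-refl top-x ∘ proj₂ , ι-gap ≤-refl (lift (suc m) ≤-refl top-x) ∘ proj₂ ]′ hitCentral
    where
    lift : ∀ i → i < suc (suc m) → ι (2 + 2 * i) ≤ℚ x → ι (2 + 2 * i) ≤ℚ y
    lift i i< ≤x with Fin.fromℕ< i< | Fin.toℕ-fromℕ< i<
    ... | f | refl with hitFixed f
    ... | inj₁ x≤ = contradiction x≤ (ι-gap ≤-refl ≤x)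
    ... | inj₂ ≤y = ≤y

    push : ∀ i → i ≤ m → ι (2 + 2 * i) ≤ℚ y → ι (2 + 2 * suc i) ≤ℚ x
    push i i≤m ≤y with onto i i≤m
    ... | k , wk with hitMoving k
    ... | inj₁ ≤x = subst (λ v → ι v ≤ℚ x)
      (trans (cong (4 +_) wk) (cong (2 +_) (sym (*-suc 2 i)))) ≤x
    ... | inj₂ y≤ = contradiction (subst (λ v → y ≤ℚ ι (1 + v)) wk y≤) (ι-gap ≤-refl ≤y)

    ascend : ∀ i → i ≤ m → ι (2 + 2 * i) ≤ℚ y
    -- The central cross starts the climb: it gives y ≥ 2, or x ≥ 2 and then y ≥ 2 by the first
    -- fixed cross.
    ascend zero    _   = [ lift 0 (s≤s z≤n) ∘ proj₁ , proj₁ ]′ hitCentral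
    ascend (suc i) i<m =
      lift (suc i) (s≤s (m≤n⇒m≤1+n i<m)) (push i (<⇒≤ i<m) (ascend i (<⇒≤ i<m)))

    top-x : ι (2 + 2 * suc m) ≤ℚ x
    top-x = push m ≤-refl (ascend m ≤-refl)

  -- A coordinate beyond the first two hits the crosses of at most one group, and there are
  -- more groups than such coordinates.
  onto⇒unpierced : ∀ {w : Fin (suc m) → ℕ} → (∀ i → i ≤ m → ∃ λ k → w k ≡ 2 * i) →
    ∀ p → ¬ (∀ κ → Hit w κ p)
  onto⇒unpierced {w} onto p hit = clash (Fin.pigeonhole ≤-refl (proj₁ ∘ hitter))
    where
    Separates : Fin (suc e) → Fin e → Set
    Separates g j = ι (2 * toℕ g) ≤ℚ p (fsuc (fsuc j)) × p (fsuc (fsuc j)) ≤ℚ ι (1 + 2 * toℕ g)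

    hitter : ∀ g → ∃ (Separates g)
    hitter g with Fin.any? (λ j → (ι (2 * toℕ g) ℚ.≤? p (fsuc (fsuc j)))
                          ×-dec (p (fsuc (fsuc j)) ℚ.≤? ι (1 + 2 * toℕ g)))
    ... | yes found = found
    -- All crosses of a group share their intervals beyond the plane, so if none of these is hit,
    -- the whole group is hit in the plane.
    ... | no none   = ⊥-elim (climb {w} onto hitFixed hitMoving hitCentral)
      where
      hitFixed : ∀ i → p fzero ≤ℚ ι (1 + 2 * toℕ i) ⊎ ι (2 + 2 * toℕ i) ≤ℚ p (fsuc fzero)
      hitFixed i with hit (g , fixed i)
      ... | fzero , _ , x≤         = inj₁ x≤
      ... | fsuc fzero , ≤y , _    = inj₂ ≤y
      ... | fsuc (fsuc j) , inside = contradiction (j , inside) none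

      hitMoving : ∀ k → ι (4 + w k) ≤ℚ p fzero ⊎ p (fsuc fzero) ≤ℚ ι (1 + w k)
      hitMoving k with hit (g , moving k)
      ... | fzero , ≤x , _         = inj₁ ≤x
      ... | fsuc fzero , _ , y≤    = inj₂ y≤
      ... | fsuc (fsuc j) , inside = contradiction (j , inside) none

      hitCentral : (ι 2 ≤ℚ p fzero × p fzero ≤ℚ ι (1 + 2 * suc m)) ⊎
        (ι 2 ≤ℚ p (fsuc fzero) × p (fsuc fzero) ≤ℚ ι (1 + 2 * suc m))
      hitCentral with hit (g , central)
      ... | fzero , inside         = inj₁ inside
      ... | fsuc fzero , inside    = inj₂ inside
      ... | fsuc (fsuc j) , inside = contradiction (j , inside) none

    clash : ¬ (∃₂ λ g g′ → g Fin.< g′ × proj₁ (hitter g) ≡ proj₁ (hitter g′))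
    clash (g , g′ , g<g′ , same) with hitter g | hitter g′
    clash (g , g′ , g<g′ , refl) | j , _ , ≤g | .j , g′≤ , _ = ι-gap separated g′≤ ≤g
      where
      separated : 1 + 2 * toℕ g < 2 * toℕ g′
      separated = ≤-trans (≤-reflexive (sym (*-suc 2 (toℕ g)))) (*-monoʳ-≤ 2 g<g′)

  -- As low as fixed cross i allows and as far right as fixed cross i + 1 allows. The other
  -- coordinates get the default 0, which lies in the box.
  corner : ℕ → Fin (2 + e) → ℕ
  corner i fzero           = 3 + 2 * i
  corner i (fsuc fzero)    = 2 + 2 * i
  corner i (fsuc (fsuc j)) = 0

  corner≤bound : ∀ {i} → i ≤ m → ∀ j → corner i j ≤ bound
  corner≤bound i≤m fzero           = s≤s (2+2*≤ (m≤n⇒m≤1+n i≤m))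
  corner≤bound i≤m (fsuc fzero)    = m≤n⇒m≤1+n (2+2*≤ (m≤n⇒m≤1+n i≤m))
  corner≤bound i≤m (fsuc (fsuc j)) = z≤n

  -- Fixed crosses after i are hit in x, the others in y. A moving cross is hit in x if
  -- `w k < 2 * i` and in y if `w k > 2 * i`; only equality escapes.
  corner-hits : ∀ {w i} → i ≤ m → (∀ k → w k ≢ 2 * i) → ∀ κ → Hit w κ (ι ∘ corner i)
  corner-hits {w} {i} i≤m missed (g , fixed j) with <-≤-connex i (toℕ j)
  ... | inj₁ i<j = fzero , ι-mono-≤ z≤n , ι-mono-≤
    (s≤s (≤-trans (≤-reflexive (sym (*-suc 2 i))) (*-monoʳ-≤ 2 i<j)))
  ... | inj₂ j≤i = fsuc fzero , ι-mono-≤ (+-monoʳ-≤ 2 (*-monoʳ-≤ 2 j≤i)) ,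
    ι-mono-≤ (corner≤bound i≤m (fsuc fzero))
  corner-hits {w} {i} i≤m missed (g , moving k) with <-cmp (w k) (2 * i)
  ... | tri< wk< _ _ = fzero , ι-mono-≤ (+-monoʳ-≤ 3 wk<) , ι-mono-≤ (corner≤bound i≤m fzero)
  ... | tri≈ _ wk≡ _ = contradiction wk≡ (missed k)
  ... | tri> _ _ <wk = fsuc fzero , ι-mono-≤ z≤n , ι-mono-≤ (s≤s <wk)
  corner-hits {w} {i} i≤m missed (g , central) = fzero , ι-mono-≤ (s≤s (s≤s z≤n)) ,
    ι-mono-≤ (s≤s (≤-trans (≤-reflexive (sym (*-suc 2 i))) (*-monoʳ-≤ 2 (s≤s i≤m))))

  lower<upper : ∀ {w} → (∀ k → w k ≤ 2 * m) → ∀ j κ → lower w j κ < upper w j κ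
  lower<upper w≤ fzero        (g , fixed i)  = s≤s z≤n
  lower<upper w≤ fzero        (g , moving k) =
    +-monoʳ-≤ 5 (≤-trans (w≤ k) (m≤m+n (2 * m) (2 * e)))
  lower<upper w≤ fzero        (g , central)  =
    s≤s (*-monoʳ-≤ 2 (s≤s (z≤n {m})))
  lower<upper w≤ (fsuc fzero) (g , fixed i)  = s≤s (2+2*≤ (≤-pred (Fin.toℕ<n i)))
  lower<upper w≤ (fsuc fzero) (g , moving k) = s≤s z≤n
  lower<upper w≤ (fsuc fzero) (g , central)  = s≤s (*-monoʳ-≤ 2 (s≤s (z≤n {m})))
  lower<upper w≤ (fsuc (fsuc j)) (g , s)     = ≤-refl

  upper≤bound : ∀ {w} → (∀ k → w k ≤ 2 * m) → ∀ j κ → upper w j κ ≤ bound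
  upper≤bound w≤ fzero        (g , fixed i)  =
    ≤-trans (n≤1+n _) (m≤n⇒m≤1+n (2+2*≤ (≤-pred (Fin.toℕ<n i))))
  upper≤bound w≤ fzero        (g , moving k) = ≤-refl
  upper≤bound w≤ fzero        (g , central)  = ≤-trans (n≤1+n _) (m≤n⇒m≤1+n (2+2*≤ ≤-refl))
  upper≤bound w≤ (fsuc fzero) (g , fixed i)  = ≤-refl
  upper≤bound w≤ (fsuc fzero) (g , moving k) =
    +-mono-≤ (s≤s (z≤n {4})) (≤-trans (w≤ k) (m≤m+n (2 * m) (2 * e)))
  upper≤bound w≤ (fsuc fzero) (g , central)  = ≤-trans (n≤1+n _) (m≤n⇒m≤1+n (2+2*≤ ≤-refl))
  upper≤bound w≤ (fsuc (fsuc j)) (g , s)     = +-mono-≤ (s≤s (z≤n {4}))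
    (≤-trans (*-monoʳ-≤ 2 (≤-pred (Fin.toℕ<n g))) (m≤n+m (2 * e) (2 * m)))

  lower-midpoint : ∀ {w u v} → (∀ k → 2 * w k ≡ u k + v k) →
    ∀ j κ → 2 * lower w j κ ≡ lower u j κ + lower v j κ
  lower-midpoint mid fzero           (g , fixed i)  = refl
  lower-midpoint {w} {u} {v} mid fzero (g , moving k) = begin
    2 * (4 + w k)            ≡⟨ *-distribˡ-+ 2 4 (w k) ⟩
    8 + 2 * w k              ≡⟨ cong (8 +_) (mid k) ⟩
    4 + (4 + (u k + v k))    ≡⟨ cong (4 +_) (x∙yz≈y∙xz 4 (u k) (v k)) ⟩
    (4 + u k) + (4 + v k)    ∎
    where open ≡-Reasoning
  lower-midpoint mid fzero           (g , central)  = refl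
  lower-midpoint mid (fsuc fzero)    (g , fixed i)  = 2*≡+ (2 + 2 * toℕ i)
  lower-midpoint mid (fsuc fzero)    (g , moving k) = refl
  lower-midpoint mid (fsuc fzero)    (g , central)  = refl
  lower-midpoint mid (fsuc (fsuc j)) (g , s)        = 2*≡+ (2 * toℕ g)

  upper-midpoint : ∀ {w u v} → (∀ k → 2 * w k ≡ u k + v k) →
    ∀ j κ → 2 * upper w j κ ≡ upper u j κ + upper v j κ
  upper-midpoint mid fzero           (g , fixed i)  = 2*≡+ (1 + 2 * toℕ i)
  upper-midpoint mid fzero           (g , moving k) = 2*≡+ bound
  upper-midpoint mid fzero           (g , central)  = 2*≡+ (1 + 2 * suc m)
  upper-midpoint mid (fsuc fzero)    (g , fixed i)  = 2*≡+ bound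
  upper-midpoint {w} {u} {v} mid (fsuc fzero) (g , moving k) = begin
    2 * (1 + w k)            ≡⟨ *-distribˡ-+ 2 1 (w k) ⟩
    2 + 2 * w k              ≡⟨ cong (2 +_) (mid k) ⟩
    1 + (1 + (u k + v k))    ≡⟨ cong (1 +_) (x∙yz≈y∙xz 1 (u k) (v k)) ⟩
    (1 + u k) + (1 + v k)    ∎
    where open ≡-Reasoning
  upper-midpoint mid (fsuc fzero)    (g , central)  = 2*≡+ (1 + 2 * suc m)
  upper-midpoint mid (fsuc (fsuc j)) (g , s)        = 2*≡+ (1 + 2 * toℕ g)

-- Inputs made of these crosses, and the factorial bound on the cost

module Inputs {e m N : ℕ} (decode : Fin N → Kind e m) (encode : Kind e m → Fin N)
  (decode∘encode : ∀ κ → decode (encode κ) ≡ κ) where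

  open Crosses e m

  endpoint : (Fin (suc m) → ℕ) → Fin (2 + e) → Endpoint N → ℕ
  endpoint w j (fzero  , false) = 0
  endpoint w j (fzero  , true)  = bound
  endpoint w j (fsuc i , false) = lower w j (decode i)
  endpoint w j (fsuc i , true)  = upper w j (decode i)

  input : (Fin (suc m) → ℕ) → Input (2 + e) N
  input w = mkInput (λ j i → ι (endpoint w j (i , false))) (λ j i → ι (endpoint w j (i , true)))

  value-input : ∀ w j ep → value (input w) j ep ≡ ι (endpoint w j ep)
  value-input w j (i , false) = refl
  value-input w j (i , true)  = refl

  ask-input : ∀ w j ep ep′ →
    ask j ep ep′ (input w) ≡ compareℕ (endpoint w j ep) (endpoint w j ep′)
  ask-input w j ep ep′ = trans (cong₂ compareℚ (value-input w j ep) (value-input w j ep′))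
    (compare-ι (endpoint w j ep) (endpoint w j ep′))

  endpoint-midpoint : ∀ {w u v} → (∀ k → 2 * w k ≡ u k + v k) →
    ∀ j ep → 2 * endpoint w j ep ≡ endpoint u j ep + endpoint v j ep
  endpoint-midpoint mid j (fzero  , false) = refl
  endpoint-midpoint mid j (fzero  , true)  = 2*≡+ bound
  endpoint-midpoint mid j (fsuc i , false) = lower-midpoint mid j (decode i)
  endpoint-midpoint mid j (fsuc i , true)  = upper-midpoint mid j (decode i)

  ask-midpoint : ∀ {w u v} → (∀ k → 2 * w k ≡ u k + v k) → ∀ j ep ep′ →
    ask j ep ep′ (input u) ≡ ask j ep ep′ (input v) →
    ask j ep ep′ (input w) ≡ ask j ep ep′ (input u)
  ask-midpoint {w} {u} {v} mid j ep ep′ same = begin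
    ask j ep ep′ (input w)                            ≡⟨ ask-input w j ep ep′ ⟩
    compareℕ (endpoint w j ep) (endpoint w j ep′)
      ≡⟨ compareℕ-midpoint (endpoint-midpoint mid j ep) (endpoint-midpoint mid j ep′)
           (trans (sym (ask-input u j ep ep′)) (trans same (ask-input v j ep ep′))) ⟩
    compareℕ (endpoint u j ep) (endpoint u j ep′)     ≡⟨ ask-input u j ep ep′ ⟨
    ask j ep ep′ (input u)                            ∎
    where open ≡-Reasoning

  input-admissible : ∀ {w} → (∀ k → w k ≤ 2 * m) → Admissible (input w)
  input-admissible {w} w≤ = nonempty , inside
    where
    nonempty : ∀ j i → ι (endpoint w j (i , false)) <ℚ ι (endpoint w j (i , true))
    nonempty j fzero    = ι-mono-< (s≤s z≤n)
    nonempty j (fsuc i) = ι-mono-< (lower<upper w≤ j (decode i))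

    inside : ∀ j i → (ι 0 ≤ℚ ι (endpoint w j (i , false))) ×
                     (ι (endpoint w j (i , true)) ≤ℚ ι bound)
    inside j fzero    = ι-mono-≤ z≤n , ι-mono-≤ ≤-refl
    inside j (fsuc i) = ι-mono-≤ z≤n , ι-mono-≤ (upper≤bound w≤ j (decode i))

  onto⇒empty : ∀ {w} → (∀ i → i ≤ m → ∃ λ k → w k ≡ 2 * i) → IntersectionEmpty (input w)
  onto⇒empty {w} onto (p , _ , crosses) = onto⇒unpierced onto p λ κ →
    subst (λ κ → Hit w κ p) (decode∘encode κ) (proj₂ (crosses (encode κ)))

  -- A corner excluded by no moving cross would lie in every cross. The search over `k` is finite,
  -- so an excluding cross is actually found.
  empty⇒onto : ∀ {w} → IntersectionEmpty (input w) → ∀ i → i ≤ m → ∃ λ k → w k ≡ 2 * i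
  empty⇒onto {w} empty i i≤m with Fin.any? (λ k → w k ≟ 2 * i)
  ... | yes found = found
  ... | no missed = ⊥-elim (empty (ι ∘ corner i , inBox , λ c →
    inBox , corner-hits i≤m (λ k wk → missed (k , wk)) (decode c)))
    where
    inBox : InBox (input w) (ι ∘ corner i)
    inBox j = ι-mono-≤ z≤n , ι-mono-≤ (corner≤bound i≤m j)

  -- Doubled so that the average of two weights is again a natural number.
  weight : Code (suc m) → Fin (suc m) → ℕ
  weight c k = 2 * perm c k

  weight≤ : ∀ c k → weight c k ≤ 2 * m
  weight≤ c k = *-monoʳ-≤ 2 (≤-pred (perm< c k))

  weight-onto : ∀ c i → i ≤ m → ∃ λ k → weight c k ≡ 2 * i
  weight-onto c i i≤m with perm-surjective c (s≤s i≤m)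
  ... | k , eq′ = k , cong (2 *_) eq′

  -- The averaged input reaches the same leaf and is declared empty as well. By correctness its
  -- weights exclude every corner, which forces the permutations to coincide.
  sameLeaf⇒≡ : ∀ t → Correct t → ∀ c c′ →
    SameLeaf t (input (weight c)) (input (weight c′)) → c ≡ c′
  sameLeaf⇒≡ t correct c c′ same = midpoint-surjective⇒≡ c c′ λ i i<n →
    empty⇒onto (Equivalence.to (correct (input w) (input-admissible w≤)) (begin
      run t (input w)             ≡⟨ run-between (ask-midpoint mid) same ⟩
      run t (input (weight c))
        ≡⟨ Equivalence.from (correct _ (input-admissible (weight≤ c)))
             (onto⇒empty (weight-onto c)) ⟩
      true                        ∎)) i (≤-pred i<n)
    where
    open ≡-Reasoning

    w : Fin (suc m) → ℕ
    w k = perm c k + perm c′ k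

    mid : ∀ k → 2 * w k ≡ weight c k + weight c′ k
    mid k = *-distribˡ-+ 2 (perm c k) (perm c′ k)

    w≤ : ∀ k → w k ≤ 2 * m
    w≤ k = ≤-trans (+-mono-≤ (≤-pred (perm< c k)) (≤-pred (perm< c′ k)))
      (≤-reflexive (sym (2*≡+ m)))

  cost-bound : ∀ t → Correct t →
    ∃ λ I → Admissible I × length (codes (suc m)) ≤ 3 ^ cost t I
  cost-bound t correct =
    let c , _ , big = fooling-bound (input ∘ weight) t (codes (suc m)) (codes-unique (suc m))
          (1≤length-codes (suc m)) (λ {c} {c′} _ _ → sameLeaf⇒≡ t correct c c′)
    in input (weight c) , input-admissible (weight≤ c) , big

-- Counting

-- Induction on the value of the logarithm, which drops by one when `n` is halved.
2^⌊log₂⌋≤ : ∀ n → 1 ≤ n → 2 ^ ⌊log₂ n ⌋ ≤ n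
2^⌊log₂⌋≤ n 1≤n = go ⌊log₂ n ⌋ n 1≤n refl
  where
  go : ∀ k n → 1 ≤ n → ⌊log₂ n ⌋ ≡ k → 2 ^ k ≤ n
  go zero    n             1≤n _   = 1≤n
  go (suc k) (suc zero)    _   log = contradiction (trans (sym (⌊log₂[2^n]⌋≡n 0)) log) λ ()
  go (suc k) (suc (suc n)) _   log = begin
    2 * 2 ^ k                              ≤⟨ *-monoʳ-≤ 2 (go k (suc ⌊ n /2⌋) (s≤s z≤n)
      (trans (⌊log₂⌊n/2⌋⌋≡⌊log₂n⌋∸1 (suc (suc n))) (cong (_∸ 1) log))) ⟩
    2 * suc ⌊ n /2⌋                        ≡⟨ *-suc 2 ⌊ n /2⌋ ⟩
    2 + 2 * ⌊ n /2⌋                        ≡⟨ cong (2 +_) (2*≡+ ⌊ n /2⌋) ⟩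
    2 + (⌊ n /2⌋ + ⌊ n /2⌋)
      ≤⟨ +-monoʳ-≤ 2 (+-monoʳ-≤ ⌊ n /2⌋ (⌊n/2⌋≤⌈n/2⌉ n)) ⟩
    2 + (⌊ n /2⌋ + ⌈ n /2⌉)                ≡⟨ cong (2 +_) (⌊n/2⌋+⌈n/2⌉≡n n) ⟩
    2 + n                                  ∎
    where open ≤-Reasoning

<2^suc⌊log₂⌋ : ∀ n → n < 2 ^ suc ⌊log₂ n ⌋
<2^suc⌊log₂⌋ n = ≰⇒> λ 2^≤n → <-irrefl refl (begin-strict
  ⌊log₂ n ⌋                         <⟨ ≤-refl ⟩
  suc ⌊log₂ n ⌋                     ≡⟨ ⌊log₂[2^n]⌋≡n (suc ⌊log₂ n ⌋) ⟨
  ⌊log₂ 2 ^ suc ⌊log₂ n ⌋ ⌋         ≤⟨ ⌊log₂⌋-mono-≤ 2^≤n ⟩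
  ⌊log₂ n ⌋                         ∎)
  where open ≤-Reasoning

≤2^ : ∀ n → n ≤ 2 ^ n
≤2^ zero    = z≤n
≤2^ (suc n) = begin
  1 + n              ≤⟨ +-mono-≤ (^-monoʳ-≤ 2 (z≤n {n})) (≤2^ n) ⟩
  2 ^ n + 2 ^ n      ≡⟨ 2*≡+ (2 ^ n) ⟨
  2 * 2 ^ n          ∎
  where open ≤-Reasoning

-- Replacing 3 by 4 turns both sides into powers of 2, whose exponents can be compared.
h*2^h≤2*c : ∀ h c → (2 ^ h) ^ (2 ^ h) ≤ 3 ^ c → h * 2 ^ h ≤ 2 * c
h*2^h≤2*c h c big = ≮⇒≥ λ 2c< → <⇒≱ (^-monoʳ-< 2 ≤-refl 2c<) (begin
  2 ^ (h * 2 ^ h)      ≡⟨ ^-*-assoc 2 h (2 ^ h) ⟨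
  (2 ^ h) ^ (2 ^ h)    ≤⟨ big ⟩
  3 ^ c                ≤⟨ ^-monoˡ-≤ c (n≤1+n 3) ⟩
  4 ^ c                ≡⟨ ^-*-assoc 2 2 c ⟩
  2 ^ (2 * c)          ∎)
  where open ≤-Reasoning

-- A group has 2m + 4 crosses; padding by 2m gives 4(m + 1), which is 8 times `2 ^ h`.
cross-count : ∀ e s m h → 8 * suc e ≤ 2 ^ s → suc m ≡ 2 * 2 ^ h →
  suc e * shapeCount m ≤ 2 ^ (h + s)
cross-count e s m h groups size = begin
  suc e * shapeCount m           ≤⟨ *-monoʳ-≤ (suc e) (m≤m+n (shapeCount m) (2 * m)) ⟩
  suc e * (shapeCount m + 2 * m) ≡⟨ cong (suc e *_) (quadruple m) ⟩
  suc e * (4 * suc m)            ≡⟨ cong (λ n → suc e * (4 * n)) size ⟩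
  suc e * (4 * (2 * 2 ^ h))      ≡⟨ regroup (suc e) (2 ^ h) ⟩
  2 ^ h * (8 * suc e)            ≤⟨ *-monoʳ-≤ (2 ^ h) groups ⟩
  2 ^ h * 2 ^ s                  ≡⟨ ^-distribˡ-+-* 2 h s ⟨
  2 ^ (h + s)                    ∎
  where
  open ≤-Reasoning

  quadruple : ∀ m → suc (suc (suc m) + suc m) + 2 * m ≡ 4 * suc m
  quadruple = solve-∀

  regroup : ∀ a b → a * (4 * (2 * b)) ≡ b * (8 * a)
  regroup = solve-∀

predecessor-of-2^ : ∀ h → ∃ λ m → suc m ≡ 2 ^ h
predecessor-of-2^ h with 2 ^ h | ^-monoʳ-≤ 2 (z≤n {h})
... | suc n | _ = n , refl

-- With L = ⌊log₂ N⌋ and h = L − s, the 2(2ʰ⁺¹ + 1) crosses of each of the e + 1 groups fit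
-- into N, and h ≥ L / 2.
module Large (e s : ℕ) (groups : 8 * suc e ≤ 2 ^ s) (N : ℕ) (2^s+s≤N : 2 ^ (s + s) ≤ N) where

  L h : ℕ
  L = ⌊log₂ N ⌋
  h = L ∸ s

  s+s≤L : s + s ≤ L
  s+s≤L = subst (_≤ L) (⌊log₂[2^n]⌋≡n (s + s)) (⌊log₂⌋-mono-≤ 2^s+s≤N)

  h+s≡L : h + s ≡ L
  h+s≡L = m∸n+n≡m (≤-trans (m≤m+n s s) s+s≤L)

  s≤h : s ≤ h
  s≤h = +-cancelʳ-≤ s s h (subst (s + s ≤_) (sym h+s≡L) s+s≤L)

  L≤2*h : L ≤ 2 * h
  L≤2*h = begin
    L          ≡⟨ h+s≡L ⟨
    h + s      ≤⟨ +-monoʳ-≤ h s≤h ⟩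
    h + h      ≡⟨ 2*≡+ h ⟨
    2 * h      ∎
    where open ≤-Reasoning

  2^h+s≤N : 2 ^ (h + s) ≤ N
  2^h+s≤N = subst (λ l → 2 ^ l ≤ N) (sym h+s≡L)
    (2^⌊log₂⌋≤ N (≤-trans (^-monoʳ-≤ 2 (z≤n {s + s})) 2^s+s≤N))

  N≤2*2^h*2^s : N ≤ 2 * (2 ^ h * 2 ^ s)
  N≤2*2^h*2^s = begin
    N                        ≤⟨ <⇒≤ (<2^suc⌊log₂⌋ N) ⟩
    2 * 2 ^ L                ≡⟨ cong (λ l → 2 * 2 ^ l) h+s≡L ⟨
    2 * 2 ^ (h + s)          ≡⟨ cong (2 *_) (^-distribˡ-+-* 2 h s) ⟩
    2 * (2 ^ h * 2 ^ s)      ∎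
    where open ≤-Reasoning

  -- Rounding costs constant factors only: `N` exceeds `2 ^ h` by at most `2 * 2 ^ s`, and `L`
  -- exceeds `h` by at most 2.
  N*L≤ : ∀ c → h * 2 ^ h ≤ 2 * c → 1 * (N * L) ≤ 8 * 2 ^ s * c
  N*L≤ c h*2^h≤ = begin
    1 * (N * L)                        ≡⟨ *-identityˡ (N * L) ⟩
    N * L                              ≤⟨ *-mono-≤ N≤2*2^h*2^s L≤2*h ⟩
    2 * (2 ^ h * 2 ^ s) * (2 * h)      ≡⟨ collect (2 ^ h) (2 ^ s) h ⟩
    4 * 2 ^ s * (h * 2 ^ h)            ≤⟨ *-monoʳ-≤ (4 * 2 ^ s) h*2^h≤ ⟩
    4 * 2 ^ s * (2 * c)                ≡⟨ double (2 ^ s) c ⟩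
    8 * 2 ^ s * c                      ∎
    where
    open ≤-Reasoning

    collect : ∀ a b h → 2 * (a * b) * (2 * h) ≡ 4 * b * (h * a)
    collect = solve-∀

    double : ∀ b c → 4 * b * (2 * c) ≡ 8 * b * c
    double = solve-∀

  costly-input : (t : Tree (2 + e) N) → Correct t →
    ∃ λ I → Admissible I × 1 * (N * L) ≤ 8 * 2 ^ s * cost t I
  costly-input t correct =
    -- With `2 ^ suc h` corners, the upper half of the factors of the factorial already yields
    -- `(2 ^ h) ^ (2 ^ h)`.
    let m , size = predecessor-of-2^ (suc h)
        decode , encode , decode∘encode =
          kinds e m (≤-trans (cross-count e s m h groups size) 2^h+s≤N)
        I , admissible , big = Inputs.cost-bound decode encode decode∘encode t correct
    in I , admissible , N*L≤ (cost t I) (h*2^h≤2*c h (cost t I)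
      (≤-trans (^-≤-length-codes (2 ^ h) (2 ^ h))
        (subst (λ n → length (codes n) ≤ 3 ^ cost t I) (trans size (2*≡+ (2 ^ h))) big)))

theorem2 : ∀ (d : ℕ) → 2 ≤ d →
    ∃ λ (p : ℕ) → ∃ λ (q : ℕ) → (1 ≤ p) × (1 ≤ q) × (∃ λ (N₀ : ℕ) →
    ∀ (N : ℕ) → N₀ ≤ N → (t : Tree d N) → Correct t →
    ∃ λ (I : Input d N) → Admissible I × (p * (N * ⌊log₂ N ⌋) ≤ q * cost t I))
theorem2 (suc (suc e)) (s≤s (s≤s z≤n)) =
  -- The threshold `2 ^ (s + s)` makes the logarithm of `N` at least 2s, so subtracting `s` loses at
  -- most half of it.
  1 , 8 * 2 ^ s , ≤-refl , *-mono-≤ (s≤s (z≤n {7})) (^-monoʳ-≤ 2 (z≤n {s})) ,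
  2 ^ (s + s) , λ N N₀≤N → Large.costly-input e s groups N N₀≤N
  where
  s : ℕ
  -- The 3 absorbs the factor 8, and `suc e` is at most `2 ^ suc e`.
  s = 3 + suc e

  groups : 8 * suc e ≤ 2 ^ s
  groups = ≤-trans (*-monoʳ-≤ 8 (≤2^ (suc e))) (≤-reflexive (sym (^-distribˡ-+-* 2 3 (suc e))))
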